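{- For every chordal graph $G$, $\operatorname{box}(G)\le \omega(G)+1\le \Delta(G)+2$.
   Context: A graph is chordal if every cycle of length at least 4 has a chord (an edge joining two non-consecutive vertices of the cycle). $\omega(G)$ is the clique number (maximum size of a clique) and $\Delta(G)$ is the maximum degree. The boxicity $\operatorname{box}(G)$ is the minimum $b$ such that $G$ is the intersection graph of axis-parallel boxes in $\mathbb{R}^b$ (products of $b$ closed intervals), one box per vertex. -}

module Defs where

open import Data.Bool using (true)
open import Data.Fin using (Fin; zero; suc; toℕ; fromℕ<; splitAt; _↑ˡ_; _↑ʳ_)
open import Data.Fin.Properties using (_≟_; all?; any?; toℕ-fromℕ<; splitAt-↑ˡ; splitAt-↑ʳ)
open import Data.Fin.Subset using (Subset; _∈_; ∣_∣; ⊥)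
open import Data.Fin.Subset.Properties using (_∈?_; ∉⊥; ∣⊥∣≡0; ∣p∣≤n; anySubset?; p⊆q⇒∣p∣≤∣q∣; p⊂q⇒∣p∣<∣q∣)
open import Data.Integer using (+_; +≤+; +<+)
open import Data.List using (map; allFin)
open import Data.List.Extrema.Nat using (max)
open import Data.Nat as ℕ using (ℕ; zero; suc; _≤_; z≤n; s≤s)
import Data.Nat.Properties as ℕ
open import Data.Nat.Coprimality using (1-coprimeTo) renaming (sym to coprime-sym)
open import Data.Product using (∃; ∃-syntax; _×_; _,_; proj₁; proj₂)
open import Data.Rational as ℚ using (ℚ; mkℚ; *<*)
import Data.Rational.Properties as ℚ
open import Data.Sum using (_⊎_; inj₁; inj₂; [_,_]′)
open import Data.Vec using (Vec; []; _∷_; lookup; tabulate)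
open import Data.Vec.Properties using (lookup∘tabulate; []=⇒lookup; lookup⇒[]=)
open import Data.Vec.Functional using (Vector)
open import Function using (_∘_; _⇔_; mk⇔; Equivalence)
open import Function.Definitions using (Injective)
open import Level using (Level; 0ℓ)
open import Relation.Binary using (Rel; Symmetric; Irreflexive; tri<; tri≈; tri>) renaming (Decidable to Decidable₂)
open import Relation.Binary.PropositionalEquality using (_≡_; _≢_; refl; sym; trans; cong; subst; subst₂)
open import Relation.Nullary using (¬_; Dec; yes; no; contradiction; does)
open import Relation.Nullary.Decidable using (¬?; _×-dec_; _→-dec_; map′; decidable-stable; ¬¬-excluded-middle)
open import Relation.Unary using (Pred; Decidable)

private
  variable
    ℓ : Level
    n b : ℕ

IsMinimum : Pred ℕ ℓ → Pred ℕ ℓ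
IsMinimum P m = P m × (∀ k → P k → m ≤ k)

IsMaximum : Pred ℕ ℓ → Pred ℕ ℓ
IsMaximum P m = P m × (∀ k → P k → k ≤ m)

minimum : {P : Pred ℕ ℓ} → Decidable P → ∀ k → P k → ∃ (IsMinimum P)
minimum P? k p with P? 0
minimum P? k       p | yes p₀ = 0 , p₀ , λ _ _ → z≤n
minimum P? zero    p | no ¬p₀ = contradiction p ¬p₀
minimum {P = P} P? (suc k) p | no ¬p₀ with minimum (P? ∘ suc) k p
... | m , pm , least = suc m , pm , λ where
  zero    q → contradiction q ¬p₀
  (suc j) q → s≤s (least j q)

maximum : {P : Pred ℕ ℓ} → Decidable P → P 0 →
          ∀ k → (∀ j → P j → j ≤ k) → ∃ (IsMaximum P)
maximum P? p₀ zero    bound = 0 , p₀ , bound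
maximum P? p₀ (suc k) bound with P? (suc k)
... | yes p = suc k , p , bound
... | no ¬p = maximum P? p₀ k λ j pj →
  ℕ.≤-pred (ℕ.≤∧≢⇒< (bound j pj) λ { refl → ¬p pj })

record Graph (n : ℕ) : Set₁ where
  infix 4 _~_ _~?_
  field
    _~_      : Rel (Fin n) 0ℓ
    _~?_     : Decidable₂ _~_
    ~-sym    : Symmetric _~_
    ~-irrefl : Irreflexive _≡_ _~_

-- Cyclic successor: j ≡ i + 1 (mod k).

Next : ∀ {k} → Rel (Fin k) 0ℓ
Next {k} i j = toℕ j ≡ suc (toℕ i) ⊎ (suc (toℕ i) ≡ k × toℕ j ≡ 0)

Consecutive : ∀ {k} → Rel (Fin k) 0ℓ
Consecutive i j = Next i j ⊎ Next j i

module _ (G : Graph n) where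
  open Graph G

  record Cycle (k : ℕ) : Set where
    field
      vertex    : Fin k → Fin n
      injective : Injective _≡_ _≡_ vertex
      edge      : ∀ i j → Next i j → vertex i ~ vertex j

  HasChord : ∀ {k} → Cycle k → Set
  HasChord c = ∃[ i ] ∃[ j ] (i ≢ j × ¬ Consecutive i j × vertex i ~ vertex j)
    where open Cycle c

  Chordal : Set
  Chordal = ∀ k → 4 ≤ k → (c : Cycle k) → HasChord c

  IsClique : Pred (Subset n) 0ℓ
  IsClique p = ∀ u v → u ∈ p → v ∈ p → u ≢ v → u ~ v

  HasCliqueOfSize : Pred ℕ 0ℓ
  HasCliqueOfSize k = ∃[ p ] (IsClique p × ∣ p ∣ ≡ k)

  cliqueNumber : ∃ (IsMaximum HasCliqueOfSize)
  cliqueNumber = maximum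
    (λ k → anySubset? λ p →
      (all? λ u → all? λ v → (u ∈? p) →-dec ((v ∈? p) →-dec (¬? (u ≟ v) →-dec (u ~? v))))
      ×-dec (∣ p ∣ ℕ.≟ k))
    (⊥ , (λ _ _ u∈⊥ → contradiction u∈⊥ ∉⊥) , ∣⊥∣≡0 n)
    n
    λ { _ (p , _ , refl) → ∣p∣≤n p }

  ω : ℕ
  ω = proj₁ cliqueNumber

  neighbours : Fin n → Subset n
  neighbours v = tabulate λ u → does (v ~? u)

  degree : Fin n → ℕ
  degree v = ∣ neighbours v ∣

  -- The graph without vertices gets Δ = 0.
  Δ : ℕ
  Δ = max 0 (map degree (allFin n))

-- Two-sided Dedekind cuts of ℚ; x and y are the same real number when
-- x ≤ᴿ y and y ≤ᴿ x.

record ℝ : Set₁ where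
  field
    L U         : Pred ℚ 0ℓ
    L-inhabited : ∃ L
    U-inhabited : ∃ U
    L-lower     : ∀ {p q} → p ℚ.< q → L q → L p
    U-upper     : ∀ {p q} → p ℚ.< q → U p → U q
    L-rounded   : ∀ {p} → L p → ∃[ q ] (p ℚ.< q × L q)
    U-rounded   : ∀ {q} → U q → ∃[ p ] (p ℚ.< q × U p)
    disjoint    : ∀ {q} → ¬ (L q × U q)
    located     : ∀ {p q} → p ℚ.< q → L p ⊎ U q

open ℝ

infix 4 _≤ᴿ_
_≤ᴿ_ : Rel ℝ 0ℓ
x ≤ᴿ y = ∀ {q} → L x q → L y q

-- Closed and nonempty.
record Interval : Set₁ where
  field
    lo hi : ℝ
    lo≤hi : lo ≤ᴿ hi

open Interval

Box : ℕ → Set₁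
Box b = Vector Interval b

infix 4 _∈ᴮ_
_∈ᴮ_ : Vector ℝ b → Box b → Set
x ∈ᴮ B = ∀ i → lo (B i) ≤ᴿ x i × x i ≤ᴿ hi (B i)

Intersect : Box b → Box b → Set₁
Intersect B C = ∃[ x ] (x ∈ᴮ B × x ∈ᴮ C)

IsIntersectionGraph : Graph n → (Fin n → Box b) → Set₁
IsIntersectionGraph G B = ∀ u v → u ≢ v → (u ~ v) ⇔ Intersect (B u) (B v)
  where open Graph G

BoxRepresentable : Graph n → Pred ℕ _
BoxRepresentable {n} G b = ∃[ B ] IsIntersectionGraph {n} {b} G B

-- The minimum defining the boxicity exists.  Representability in ℝᵇ is
-- decidable because it is equivalent to representability by boxes whose
-- endpoints are natural numbers bounded in terms of n, and every graph
-- is representable in ℝⁿ.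

≰ᴿ⇒≥ᴿ : ∀ {x y} → ¬ (x ≤ᴿ y) → y ≤ᴿ x
≰ᴿ⇒≥ᴿ {x} {y} x≰y {p} p∈y with L-rounded y p∈y
... | q , p<q , q∈y with located x p<q
...   | inj₁ p∈x = p∈x
...   | inj₂ q∈x = contradiction (λ {r} → x≤y {r}) x≰y
  where
  x≤y : x ≤ᴿ y
  x≤y {r} r∈x with ℚ.<-cmp r q
  ... | tri< r<q _ _ = L-lower y r<q q∈y
  ... | tri≈ _ refl _ = q∈y
  ... | tri> _ _ q<r = contradiction (L-lower x q<r r∈x , q∈x) (disjoint x)

fromℚ : ℚ → ℝ
fromℚ r = record
  { L           = ℚ._< r
  ; U           = r ℚ.<_
  ; L-inhabited = r ℚ.- ℚ.1ℚ , r-1<r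
  ; U-inhabited = r ℚ.+ ℚ.1ℚ , r<r+1
  ; L-lower     = ℚ.<-trans
  ; U-upper     = λ p<q r<p → ℚ.<-trans r<p p<q
  ; L-rounded   = λ p<r → let q , p<q , q<r = ℚ.<-dense p<r in q , p<q , q<r
  ; U-rounded   = λ r<q → let p , r<p , p<q = ℚ.<-dense r<q in p , p<q , r<p
  ; disjoint    = λ (q<r , r<q) → ℚ.<-asym q<r r<q
  ; located     = located′
  }
  where
  r<r+1 : r ℚ.< r ℚ.+ ℚ.1ℚ
  r<r+1 = subst (ℚ._< r ℚ.+ ℚ.1ℚ) (ℚ.+-identityʳ r) (ℚ.+-monoʳ-< r (*<* (+<+ (s≤s z≤n))))
  r-1<r : r ℚ.- ℚ.1ℚ ℚ.< r
  r-1<r = subst (r ℚ.- ℚ.1ℚ ℚ.<_) (ℚ.+-identityʳ r) (ℚ.+-monoʳ-< r (*<* ℤ.-<+))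
    where import Data.Integer as ℤ
  located′ : ∀ {p q} → p ℚ.< q → p ℚ.< r ⊎ r ℚ.< q
  located′ {p} p<q with ℚ.<-cmp p r
  ... | tri< p<r _ _ = inj₁ p<r
  ... | tri≈ _ refl _ = inj₂ p<q
  ... | tri> _ _ r<p = inj₂ (ℚ.<-trans r<p p<q)

fromℕ : ℕ → ℝ
fromℕ k = fromℚ (mkℚ (+ k) 0 (coprime-sym (1-coprimeTo k)))

fromℕ-mono : ∀ {j k} → j ≤ k → fromℕ j ≤ᴿ fromℕ k
fromℕ-mono {j} {k} j≤k q<j = ℚ.<-≤-trans q<j (ℚ.*≤* (ℤ.*-monoʳ-≤-nonNeg (+ 1) (+≤+ j≤k)))
  where import Data.Integer.Properties as ℤ

fromℕ-cancel : ∀ {j k} → fromℕ j ≤ᴿ fromℕ k → j ≤ k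
fromℕ-cancel {j} {k} j≤k with j ℕ.≤? k
... | yes p = p
... | no ¬p = contradiction (j≤k (*<* (ℤ.*-monoʳ-<-pos (+ 1) (+<+ (ℕ.≰⇒> ¬p))))) (ℚ.<-irrefl refl)
  where import Data.Integer.Properties as ℤ

Overlap : Rel (Box b) 0ℓ
Overlap B C = ∀ i → lo (B i) ≤ᴿ hi (C i) × lo (C i) ≤ᴿ hi (B i)

intersect⇒overlap : {B C : Box b} → Intersect B C → Overlap B C
intersect⇒overlap {B = B} {C} (x , x∈B , x∈C) i =
  (λ q → proj₂ (x∈C i) (proj₁ (x∈B i) q)) , (λ q → proj₂ (x∈B i) (proj₁ (x∈C i) q))

overlap⇒intersect : {B C : Box b} → (∀ i → lo (B i) ≤ᴿ lo (C i) ⊎ lo (C i) ≤ᴿ lo (B i)) →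
                    Overlap B C → Intersect B C
overlap⇒intersect {b} {B} {C} total o = proj₁ ∘ pt , proj₁ ∘ proj₂ ∘ pt , proj₂ ∘ proj₂ ∘ pt
  where
  pt : ∀ i → ∃[ x ] ((lo (B i) ≤ᴿ x × x ≤ᴿ hi (B i)) × (lo (C i) ≤ᴿ x × x ≤ᴿ hi (C i)))
  pt i with total i
  ... | inj₁ B≤C = lo (C i) , ((λ {_} → B≤C) , (λ {_} → proj₂ (o i))) , ((λ {_} q → q) , (λ {_} → lo≤hi (C i)))
  ... | inj₂ C≤B = lo (B i) , ((λ {_} q → q) , (λ {_} → lo≤hi (B i))) , ((λ {_} → C≤B) , (λ {_} → proj₁ (o i)))

¬¬-all : {P : Pred (Fin n) ℓ} → (∀ i → ¬ ¬ P i) → ¬ ¬ (∀ i → P i)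
¬¬-all {zero}  f ¬p = ¬p λ ()
¬¬-all {suc n} f ¬p = f zero λ p₀ → ¬¬-all (f ∘ suc) λ ps → ¬p λ { zero → p₀ ; (suc i) → ps i }

Searchable : Set → Set₁
Searchable A = ∀ {P : Pred A 0ℓ} → Decidable P → Dec (∃ P)

search-× : {A B : Set} → Searchable A → Searchable B → Searchable (A × B)
search-× sA sB P? = map′ (λ (a , b , p) → (a , b) , p) (λ ((a , b) , p) → a , b , p)
  (sA λ a → sB λ b → P? (a , b))

search-Vec : {A : Set} → Searchable A → ∀ k → Searchable (Vec A k)
search-Vec sA zero    P? = map′ (λ p → [] , p) (λ { ([] , p) → p }) (P? [])
search-Vec sA (suc k) P? = map′ (λ (a , as , p) → a ∷ as , p) (λ { (a ∷ as , p) → a , as , p })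
  (sA λ a → search-Vec sA k λ as → P? (a ∷ as))

-- Ranks of finitely many reals: they keep the order and lie in {0, …, k}.

module Rank {k : ℕ} (e : Fin k → ℝ) (≤? : ∀ i j → Dec (e i ≤ᴿ e j)) where

  below : Fin k → Subset k
  below i = tabulate λ j → does (¬? (≤? i j))

  ∈-below⁺ : ∀ {i j} → ¬ (e i ≤ᴿ e j) → j ∈ below i
  ∈-below⁺ {i} {j} i≰j = lookup⇒[]= j _ (trans (lookup∘tabulate _ j) lemma)
    where
    lemma : does (¬? (≤? i j)) ≡ true
    lemma with ≤? i j
    ... | yes i≤j = contradiction (λ {q} → i≤j {q}) i≰j
    ... | no  _   = refl

  ∈-below⁻ : ∀ {i j} → j ∈ below i → ¬ (e i ≤ᴿ e j)
  ∈-below⁻ {i} {j} j∈ with ≤? i j | trans (sym (lookup∘tabulate (λ j → does (¬? (≤? i j))) j)) ([]=⇒lookup j∈)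
  ... | no i≰j | _ = i≰j

  below-mono : ∀ {i j} → e i ≤ᴿ e j → ∀ {x} → x ∈ below i → x ∈ below j
  below-mono i≤j x∈ = ∈-below⁺ λ j≤x → ∈-below⁻ x∈ λ q → j≤x (i≤j q)

  rank : Fin k → Fin (suc k)
  rank i = fromℕ< (s≤s (∣p∣≤n (below i)))

  toℕ-rank : ∀ i → toℕ (rank i) ≡ ∣ below i ∣
  toℕ-rank i = toℕ-fromℕ< _

  rank-mono : ∀ {i j} → e i ≤ᴿ e j → toℕ (rank i) ≤ toℕ (rank j)
  rank-mono {i} {j} i≤j = subst₂ _≤_ (sym (toℕ-rank i)) (sym (toℕ-rank j))
    (p⊆q⇒∣p∣≤∣q∣ (below-mono i≤j))

  rank-cancel : ∀ {i j} → toℕ (rank i) ≤ toℕ (rank j) → e i ≤ᴿ e j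
  rank-cancel {i} {j} r with ≤? i j
  ... | yes i≤j = i≤j
  ... | no  i≰j = contradiction (subst₂ _≤_ (toℕ-rank i) (toℕ-rank j) r)
    (ℕ.<⇒≱ (p⊂q⇒∣p∣<∣q∣ (below-mono (≰ᴿ⇒≥ᴿ {e i} {e j} i≰j) , j , ∈-below⁺ i≰j , λ j∈ → ∈-below⁻ j∈ λ q → q)))

module _ (G : Graph n) where
  open Graph G

  IsGrid : (l h : Fin b → Fin n → ℕ) → Set
  IsGrid l h = (∀ i u → l i u ≤ h i u) ×
    (∀ u v → u ≢ v → (u ~ v → ∀ i → l i u ≤ h i v × l i v ≤ h i u) ×
                     ((∀ i → l i u ≤ h i v × l i v ≤ h i u) → u ~ v))

  isGrid? : (l h : Fin b → Fin n → ℕ) → Dec (IsGrid l h)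
  isGrid? l h = (all? λ i → all? λ u → l i u ℕ.≤? h i u) ×-dec
    (all? λ u → all? λ v → ¬? (u ≟ v) →-dec
      (((u ~? v) →-dec over? u v) ×-dec (over? u v →-dec (u ~? v))))
    where
    over? : ∀ u v → Dec (∀ i → l i u ≤ h i v × l i v ≤ h i u)
    over? u v = all? λ i → (l i u ℕ.≤? h i v) ×-dec (l i v ℕ.≤? h i u)

  isGrid-resp : {l h l′ h′ : Fin b → Fin n → ℕ} → (∀ i u → l i u ≡ l′ i u) → (∀ i u → h i u ≡ h′ i u) →
                IsGrid l h → IsGrid l′ h′
  isGrid-resp l≡ h≡ (l≤h , adj) =
    (λ i u → subst₂ _≤_ (l≡ i u) (h≡ i u) (l≤h i u)) ,
    λ u v u≢v →
      (λ u~v i → let p , q = proj₁ (adj u v u≢v) u~v i in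
        subst₂ _≤_ (l≡ i u) (h≡ i v) p , subst₂ _≤_ (l≡ i v) (h≡ i u) q) ,
      (λ o → proj₂ (adj u v u≢v) λ i → let p , q = o i in
        subst₂ _≤_ (sym (l≡ i u)) (sym (h≡ i v)) p , subst₂ _≤_ (sym (l≡ i v)) (sym (h≡ i u)) q)

  grid⇒representable : {l h : Fin b → Fin n → ℕ} → IsGrid l h → BoxRepresentable G b
  grid⇒representable {b} {l} {h} (l≤h , adj) = B , λ u v u≢v → mk⇔
    (λ u~v → overlap⇒intersect {B = B u} {B v} (total u v)
      λ i → let p , q = proj₁ (adj u v u≢v) u~v i in (λ {_} → fromℕ-mono p) , (λ {_} → fromℕ-mono q))
    (λ I → proj₂ (adj u v u≢v) λ i → let p , q = intersect⇒overlap {B = B u} {B v} I i in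
      fromℕ-cancel p , fromℕ-cancel q)
    where
    B : Fin n → Box b
    B u i = record { lo = fromℕ (l i u) ; hi = fromℕ (h i u) ; lo≤hi = fromℕ-mono (l≤h i u) }
    total : ∀ u v i → lo (B u i) ≤ᴿ lo (B v i) ⊎ lo (B v i) ≤ᴿ lo (B u i)
    total u v i with ℕ.≤-total (l i u) (l i v)
    ... | inj₁ p = inj₁ (λ {_} → fromℕ-mono p)
    ... | inj₂ p = inj₂ (λ {_} → fromℕ-mono p)

  Code : ℕ → Set
  Code b = Vec (Vec (Fin (suc (n ℕ.+ n)) × Fin (suc (n ℕ.+ n))) n) b

  loᶜ hiᶜ : Code b → Fin b → Fin n → ℕ
  loᶜ c i u = toℕ (proj₁ (lookup (lookup c i) u))
  hiᶜ c i u = toℕ (proj₂ (lookup (lookup c i) u))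

  code? : ∀ b → Dec (∃[ c ] IsGrid {b} (loᶜ c) (hiᶜ c))
  code? b = search-Vec (search-Vec (search-× any? any?) n) b λ c → isGrid? (loᶜ c) (hiᶜ c)

  representable⇒code : BoxRepresentable G b → ¬ ¬ (∃[ c ] IsGrid {b} (loᶜ c) (hiᶜ c))
  representable⇒code {b} (B , rep) ¬c =
    ¬¬-all (λ i → ¬¬-all λ s → ¬¬-all λ t → ¬¬-excluded-middle {A = e i s ≤ᴿ e i t}) (¬c ∘ build)
    where
    e : Fin b → Fin (n ℕ.+ n) → ℝ
    e i s = [ (λ u → lo (B u i)) , (λ u → hi (B u i)) ]′ (splitAt n s)

    build : (∀ i s t → Dec (e i s ≤ᴿ e i t)) → ∃[ c ] IsGrid {b} (loᶜ c) (hiᶜ c)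
    build ≤? = c , isGrid-resp
      (λ i u → cong (toℕ ∘ proj₁) (sym (lookup-c i u)))
      (λ i u → cong (toℕ ∘ proj₂) (sym (lookup-c i u)))
      ( (λ i u → mono i (l u) (h u) (subst₂ _≤ᴿ_ (sym (e-l i u)) (sym (e-h i u)) (lo≤hi (B u i))))
      , λ u v u≢v → let open Equivalence (rep u v u≢v) in
        (λ u~v i → let p , q = intersect⇒overlap {B = B u} {B v} (to u~v) i in
          mono i (l u) (h v) (subst₂ _≤ᴿ_ (sym (e-l i u)) (sym (e-h i v)) p) ,
          mono i (l v) (h u) (subst₂ _≤ᴿ_ (sym (e-l i v)) (sym (e-h i u)) q)) ,
        (λ o → from (overlap⇒intersect {B = B u} {B v} (total u v) λ i → let p , q = o i in
          (λ {_} → subst₂ _≤ᴿ_ (e-l i u) (e-h i v) (cancel i (l u) (h v) p)) ,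
          (λ {_} → subst₂ _≤ᴿ_ (e-l i v) (e-h i u) (cancel i (l v) (h u) q)))) )
      where
      l h : Fin n → Fin (n ℕ.+ n)
      l u = u ↑ˡ n
      h u = n ↑ʳ u
      module R i = Rank (e i) (≤? i)
      mono : ∀ i s t → e i s ≤ᴿ e i t → toℕ (R.rank i s) ≤ toℕ (R.rank i t)
      mono i s t p = R.rank-mono i {s} {t} p
      cancel : ∀ i s t → toℕ (R.rank i s) ≤ toℕ (R.rank i t) → e i s ≤ᴿ e i t
      cancel i s t p = R.rank-cancel i {s} {t} p
      e-l : ∀ i u → e i (l u) ≡ lo (B u i)
      e-l i u = cong [ _ , _ ]′ (splitAt-↑ˡ n u n)
      e-h : ∀ i u → e i (h u) ≡ hi (B u i)
      e-h i u = cong [ _ , _ ]′ (splitAt-↑ʳ n n u)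
      c : Code b
      c = tabulate λ i → tabulate λ u → R.rank i (l u) , R.rank i (h u)
      lookup-c : ∀ i u → lookup (lookup c i) u ≡ (R.rank i (l u) , R.rank i (h u))
      lookup-c i u = trans (cong (λ r → lookup r u) (lookup∘tabulate _ i)) (lookup∘tabulate _ u)
      total : ∀ u v i → lo (B u i) ≤ᴿ lo (B v i) ⊎ lo (B v i) ≤ᴿ lo (B u i)
      total u v i with ≤? i (l u) (l v)
      ... | yes p = inj₁ (λ {_} → subst₂ _≤ᴿ_ (e-l i u) (e-l i v) p)
      ... | no ¬p = inj₂ (λ {_} → ≰ᴿ⇒≥ᴿ {lo (B u i)} {lo (B v i)}
                      λ p → ¬p (subst₂ _≤ᴿ_ (sym (e-l i u)) (sym (e-l i v)) p))

  boxRepresentable? : Decidable (BoxRepresentable G)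
  boxRepresentable? b = map′ (grid⇒representable ∘ proj₂)
    (decidable-stable (code? b) ∘ representable⇒code) (code? b)

  -- In coordinate w, the vertex w gets [0,0], its neighbours [0,1] and all
  -- other vertices [1,1].
  boxRepresentable-n : BoxRepresentable G n
  boxRepresentable-n = grid⇒representable {l = l} {h} (l≤h , λ u v u≢v →
    (λ u~v w → l≤h′ w u v u≢v u~v , l≤h′ w v u (u≢v ∘ sym) (~-sym u~v)) ,
    λ o → sep u v u≢v (proj₂ (o u)))
    where
    l h : Fin n → Fin n → ℕ
    l w u with w ≟ u | w ~? u
    ... | yes _ | _     = 0
    ... | no _  | yes _ = 0
    ... | no _  | no _  = 1
    h w u with w ≟ u
    ... | yes _ = 0
    ... | no _  = 1
    l≤h : ∀ w u → l w u ≤ h w u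
    l≤h w u with w ≟ u | w ~? u
    ... | yes _ | _     = z≤n
    ... | no _  | yes _ = z≤n
    ... | no _  | no _  = ℕ.≤-refl
    l≤h′ : ∀ w u v → u ≢ v → u ~ v → l w u ≤ h w v
    l≤h′ w u v u≢v u~v with w ≟ u | w ~? u | w ≟ v
    ... | yes _ | _      | _        = z≤n
    ... | no _  | yes _  | _        = z≤n
    ... | no _  | no _   | no _     = ℕ.≤-refl
    ... | no _  | no v≁u | yes refl = contradiction (~-sym u~v) v≁u
    sep : ∀ u v → u ≢ v → l u v ≤ h u u → u ~ v
    sep u v u≢v p with u ≟ v | u ~? v | u ≟ u
    ... | yes u≡v | _       | _       = contradiction u≡v u≢v
    ... | no _    | yes u~v | _       = u~v
    ... | no _    | no _    | no u≢u  = contradiction refl u≢u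
    sep u v u≢v () | no _ | no _ | yes _

  boxicity : ∃ (IsMinimum (BoxRepresentable G))
  boxicity = minimum boxRepresentable? n boxRepresentable-n

  box : ℕ
  box = proj₁ boxicity

{-# OPTIONS --safe #-}
module Submission where

-- A chordal graph has a perfect elimination ordering (Dirac); read backwards, it
-- adds the vertices one by one, each adjacent to a clique of earlier ones.  Hence
-- greedy colouring needs only ω colours, and making the last earlier neighbour
-- of each vertex its parent yields a forest in which adjacent vertices are
-- comparable and each vertex u on the tree path from v to an earlier neighbour w
-- of v is equal or adjacent to w.  One coordinate carries nested intervals
-- representing the forest and separates incomparable vertices.  If u is an
-- ancestor of v not adjacent to it, u of colour i, then by the path property no
-- neighbour of v of colour i precedes u, which allows one coordinate for each
-- colour to separate all such pairs.

open import Data.Fin as Fin using (Fin; zero; suc; toℕ; fromℕ<)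
open import Data.Fin.Properties using (_≟_; any?; suc-injective; toℕ-fromℕ<; toℕ-injective; toℕ<n; toℕ≤pred[n])
open import Data.Fin.Subset using (Subset; inside; outside; _∈_; _∉_; _⊆_; _⊂_; _⊃_; _-_; _∪_; ⁅_⁆; ∣_∣; ⊤; ⊥)
open import Data.Fin.Subset.Induction using (Acc; acc; ⊂-wellFounded; ⊃-wellFounded)
open import Data.Fin.Subset.Properties using (_∈?_; nonempty?; ∈⊤; ∉⊥; ∣⊥∣≡0; ∣⁅x⁆∣≡1; x∈⁅x⁆; x∈⁅y⁆⇒x≡y; p⊆p∪q; q⊆p∪q; x∈p∪q⁻; p⊆q⇒∣p∣≤∣q∣; p⊂q⇒∣p∣<∣q∣; p─q⊆p; x∈p∧x≢y⇒x∈p-y; x∈p⇒p-x⊂p)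
open import Data.List using (map; allFin)
open import Data.List.Extrema.Nat using (max; xs≤max)
open import Data.List.Membership.Propositional.Properties using (∈-map⁺; ∈-allFin)
import Data.List.Relation.Unary.All as All
open import Data.Nat using (ℕ; zero; suc; _+_; _∸_; _≤_; _<_; z≤n; s≤s; z<s; _≤?_)
open import Data.Nat.Induction using (<-wellFounded)
import Data.Nat.Properties as ℕ
open import Data.Product using (∃; ∃-syntax; _×_; _,_; proj₁; proj₂)
open import Data.Sum using (_⊎_; inj₁; inj₂; [_,_]′)
open import Data.Vec using ([]; _∷_; tabulate)
open import Data.Vec.Functional using (updateAt)
open import Data.Vec.Functional.Properties using (updateAt-updates; updateAt-minimal)
open import Data.Vec.Properties using (lookup∘tabulate; []=⇒lookup; lookup⇒[]=)
open import Function using (_∘_; const)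
open import Level using (0ℓ)
open import Relation.Binary using (Rel; tri<; tri≈; tri>) renaming (Decidable to Decidable₂)
open import Relation.Binary.Construct.Closure.ReflexiveTransitive using (Star; ε; _◅_; _◅◅_; reverse)
open import Relation.Binary.PropositionalEquality using (_≡_; _≢_; refl; sym; trans; cong; subst; subst₂; ≢-sym)
open import Relation.Nullary using (¬_; yes; no; contradiction; does)
open import Relation.Nullary.Decidable using (¬?; _×-dec_; _⊎-dec_; decidable-stable; dec-true)
open import Relation.Unary using (Pred; Decidable)

open import Defs

private
  variable
    n m : ℕ

-- Finite subsets and reachability.

comprehension : {P : Pred (Fin n) 0ℓ} → Decidable P → Subset n
comprehension P? = tabulate (does ∘ P?)

∈-comprehension⁺ : {P : Pred (Fin n) 0ℓ} (P? : Decidable P) → ∀ {v} → P v → v ∈ comprehension P?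
∈-comprehension⁺ P? {v} p = lookup⇒[]= v _ (trans (lookup∘tabulate _ v) (dec-true (P? v) p))

∈-comprehension⁻ : {P : Pred (Fin n) 0ℓ} (P? : Decidable P) → ∀ {v} → v ∈ comprehension P? → P v
∈-comprehension⁻ P? {v} v∈ with P? v | trans (sym (lookup∘tabulate (does ∘ P?) v)) ([]=⇒lookup v∈)
... | yes p | _ = p

≤-max : (f : Fin n → ℕ) → ∀ v → f v ≤ max 0 (map f (allFin n))
≤-max f v = All.lookup (xs≤max 0 _) (∈-map⁺ f (∈-allFin v))

p⊂p∪⁅x⁆ : {p : Subset n} {x : Fin n} → x ∉ p → p ⊂ p ∪ ⁅ x ⁆
p⊂p∪⁅x⁆ {p = p} {x} x∉p = p⊆p∪q ⁅ x ⁆ , x , q⊆p∪q p ⁅ x ⁆ (x∈⁅x⁆ x) , x∉p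

∣p∪q∣≤∣p∣+∣q∣ : (p q : Subset n) → ∣ p ∪ q ∣ ≤ ∣ p ∣ + ∣ q ∣
∣p∪q∣≤∣p∣+∣q∣ []            []            = z≤n
∣p∪q∣≤∣p∣+∣q∣ (outside ∷ p) (outside ∷ q) = ∣p∪q∣≤∣p∣+∣q∣ p q
∣p∪q∣≤∣p∣+∣q∣ (inside  ∷ p) (outside ∷ q) = s≤s (∣p∪q∣≤∣p∣+∣q∣ p q)
∣p∪q∣≤∣p∣+∣q∣ (outside ∷ p) (inside  ∷ q) =
  subst (suc ∣ p ∪ q ∣ ≤_) (sym (ℕ.+-suc ∣ p ∣ ∣ q ∣)) (s≤s (∣p∪q∣≤∣p∣+∣q∣ p q))
∣p∪q∣≤∣p∣+∣q∣ (inside  ∷ p) (inside  ∷ q) =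
  s≤s (ℕ.≤-trans (∣p∪q∣≤∣p∣+∣q∣ p q) (ℕ.+-monoʳ-≤ ∣ p ∣ (ℕ.n≤1+n ∣ q ∣)))

image : (f : Fin m → Fin n) → (∀ {i j} → f i ≡ f j → i ≡ j) →
        ∃[ p ] (m ≤ ∣ p ∣ × ∀ {v} → v ∈ p → ∃[ i ] f i ≡ v)
image {zero}  f inj = ⊥ , z≤n , λ v∈⊥ → contradiction v∈⊥ ∉⊥
image {suc m} f inj with image (f ∘ suc) (suc-injective ∘ inj)
... | p , m≤∣p∣ , inv =
  p ∪ ⁅ f zero ⁆ , ℕ.≤-<-trans m≤∣p∣ (p⊂q⇒∣p∣<∣q∣ (p⊂p∪⁅x⁆ f0∉p)) , λ v∈ → preimage (x∈p∪q⁻ p _ v∈)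
  where
  f0∉p : f zero ∉ p
  f0∉p f0∈p with inj (proj₂ (inv f0∈p))
  ... | ()
  preimage : ∀ {v} → v ∈ p ⊎ v ∈ ⁅ f zero ⁆ → ∃[ i ] f i ≡ v
  preimage (inj₁ v∈p) with inv v∈p
  ... | i , eq = suc i , eq
  preimage (inj₂ v∈) = zero , sym (x∈⁅y⁆⇒x≡y (f zero) v∈)

-- Saturation: while some edge leaves the set, its far end is added. This stops because strict
-- growth of subsets of a finite set is well-founded.
reachable : {E : Rel (Fin n) 0ℓ} → Decidable₂ E → ∀ y →
            ∃[ C ] (y ∈ C × (∀ {c} → c ∈ C → Star E y c) × (∀ {c w} → c ∈ C → E c w → w ∈ C))
reachable {n} {E} E? y = grow ⁅ y ⁆ (⊃-wellFounded ⁅ y ⁆) (x∈⁅x⁆ y)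
  λ c∈ → subst (Star E y) (sym (x∈⁅y⁆⇒x≡y y c∈)) ε
  where
  grow : ∀ C → Acc _⊃_ C → y ∈ C → (∀ {c} → c ∈ C → Star E y c) →
         ∃[ C ] (y ∈ C × (∀ {c} → c ∈ C → Star E y c) × (∀ {c w} → c ∈ C → E c w → w ∈ C))
  grow C (acc rec) y∈C reach with any? (λ c → any? λ w → (c ∈? C) ×-dec (¬? (w ∈? C) ×-dec E? c w))
  ... | no none = C , y∈C , reach , λ {c} {w} c∈C e → decidable-stable (w ∈? C) λ w∉C → none (c , w , c∈C , w∉C , e)
  ... | yes (c , w , c∈C , w∉C , e) = grow (C ∪ ⁅ w ⁆) (rec (p⊂p∪⁅x⁆ w∉C)) (p⊆p∪q ⁅ w ⁆ y∈C)
    λ v∈ → [ reach , (λ v∈⁅w⁆ → subst (Star E y) (sym (x∈⁅y⁆⇒x≡y w v∈⁅w⁆)) (reach c∈C ◅◅ (e ◅ ε))) ]′ (x∈p∪q⁻ C _ v∈)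

-- Making room for a new point on the line.

-- Renumbering of left and right end points that makes room for the new point
-- suc t, contained in exactly those intervals that contain t.
raise-lo raise-hi : ℕ → ℕ → ℕ
raise-lo t k with k ≤? t
... | yes _ = k
... | no _  = suc k
raise-hi t k with t ≤? k
... | yes _ = suc k
... | no _  = k

raise-mono : ∀ t {j k} → j ≤ k → raise-lo t j ≤ raise-hi t k
raise-mono t {j} {k} j≤k with j ≤? t | t ≤? k
... | yes _  | yes _  = ℕ.m≤n⇒m≤1+n j≤k
... | yes _  | no _   = j≤k
... | no _   | yes _  = s≤s j≤k
... | no j≰t | no t≰k = contradiction (ℕ.≤-trans (ℕ.<⇒≤ (ℕ.≰⇒> j≰t)) j≤k) t≰k

raise-cancel : ∀ t {j k} → raise-lo t j ≤ raise-hi t k → j ≤ k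
raise-cancel t {j} {k} p with j ≤? t | t ≤? k
... | yes j≤t | yes t≤k = ℕ.≤-trans j≤t t≤k
... | yes _   | no _    = p
... | no _    | yes _   = ℕ.≤-pred p
... | no _    | no _    = ℕ.<⇒≤ p

raise-lo-cancel : ∀ t {j k} → raise-lo t j ≤ raise-lo t k → j ≤ k
raise-lo-cancel t {j} {k} p with j ≤? t | k ≤? t
... | yes _   | yes _  = p
... | yes j≤t | no k≰t = ℕ.≤-trans j≤t (ℕ.<⇒≤ (ℕ.≰⇒> k≰t))
... | no _    | yes _  = ℕ.<⇒≤ p
... | no _    | no _   = ℕ.≤-pred p

raise-lo-≤ : ∀ t {j} → j ≤ t → raise-lo t j ≤ suc t
raise-lo-≤ t {j} j≤t with j ≤? t
... | yes _  = ℕ.m≤n⇒m≤1+n j≤t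
... | no j≰t = contradiction j≤t j≰t

≤-raise-hi : ∀ t {k} → t ≤ k → suc t ≤ raise-hi t k
≤-raise-hi t {k} t≤k with t ≤? k
... | yes _  = s≤s t≤k
... | no t≰k = contradiction t≤k t≰k

raise-lo-≤⁻ : ∀ t {j} → raise-lo t j ≤ suc t → j ≤ t
raise-lo-≤⁻ t {j} p with j ≤? t
... | yes j≤t = j≤t
... | no _    = ℕ.≤-pred p

≤-raise-hi⁻ : ∀ t {k} → suc t ≤ raise-hi t k → t ≤ k
≤-raise-hi⁻ t {k} p with t ≤? k
... | yes t≤k = t≤k
... | no _    = ℕ.<⇒≤ p

-- Left ends up to `t` stay below `suc t` and all others jump past it. So a new point interval at
-- `suc t` contains no old left end, and a newly inserted vertex is an ancestor of no old one.
raise-lo≢ : ∀ t j → raise-lo t j ≢ suc t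
raise-lo≢ t j eq with j ≤? t
... | yes j≤t = ℕ.<⇒≢ (s≤s j≤t) eq
... | no j≰t  = ℕ.>⇒≢ (s≤s (ℕ.≰⇒> j≰t)) eq

module _ (G : Graph n) where
  open Graph G

  -- Walks and their shortening.

  -- `at` is total so that cutting out a segment is mere index arithmetic; its values beyond `m`
  -- carry no meaning.
  record Walk (R : Pred (Fin n) 0ℓ) (a b : Fin n) (m : ℕ) : Set where
    field
      at    : ℕ → Fin n
      start : at 0 ≡ a
      end   : at m ≡ b
      step  : ∀ {k} → k < m → at k ~ at (suc k)
      inner : ∀ {k} → 0 < k → k < m → R (at k)

  module _ {R : Pred (Fin n) 0ℓ} where

    edge-walk : ∀ {a b} → a ~ b → Walk R a b 1
    edge-walk {a} {b} a~b = record
      { at    = λ { zero → a ; (suc _) → b }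
      ; start = refl
      ; end   = refl
      ; step  = λ { {zero} _ → a~b ; {suc _} (s≤s ()) }
      ; inner = λ { {suc _} _ (s≤s ()) }
      }

    cons-walk : ∀ {a b c m} → a ~ b → R b → Walk R b c m → Walk R a c (suc m)
    cons-walk {a} {b} a~b Rb w = record
      { at    = λ { zero → a ; (suc k) → at k }
      ; start = refl
      ; end   = end
      ; step  = λ { {zero} _ → subst (a ~_) (sym start) a~b ; {suc k} (s≤s k<m) → step k<m }
      ; inner = λ { {suc zero} _ _ → subst R (sym start) Rb ; {suc (suc k)} _ (s≤s k<m) → inner z<s k<m }
      }
      where open Walk w

    -- The indices from `i + 1` to `i + d` are cut out. The first premise on `at i` bridges the gap;
    -- the second replaces it when the cut reaches the end of the walk.
    skip : ∀ {a b m} (w : Walk R a b m) → let open Walk w in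
           ∀ i d → i + d ≤ m → (i + d < m → at i ~ at (suc (i + d))) → (i + d ≡ m → at i ≡ at m) →
           Walk R a b (m ∸ d)
    skip {a} {b} {m} w i d i+d≤m jump stop = record
      { at = at′ ; start = start′ ; end = end′ ; step = step′ ; inner = inner′ }
      where
      open Walk w
      d≤m : d ≤ m
      d≤m = ℕ.≤-trans (ℕ.m≤n+m d i) i+d≤m
      i≤m∸d : i ≤ m ∸ d
      i≤m∸d = ℕ.m+n≤o⇒m≤o∸n i i+d≤m
      shift : ∀ {k} → k < m ∸ d → k + d < m
      shift {k} k< = subst (k + d <_) (ℕ.m∸n+n≡m d≤m) (ℕ.+-monoˡ-< d k<)
      at′ : ℕ → Fin n
      at′ k with k ≤? i
      ... | yes _ = at k
      ... | no _  = at (k + d)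
      start′ : at′ 0 ≡ a
      start′ with 0 ≤? i
      ... | yes _ = start
      ... | no 0≰i = contradiction z≤n 0≰i
      end′ : at′ (m ∸ d) ≡ b
      end′ with m ∸ d ≤? i
      ... | yes m∸d≤i = trans (trans (cong at (sym i≡)) (stop (trans (cong (_+ d) i≡) (ℕ.m∸n+n≡m d≤m)))) end
        where
        i≡ : i ≡ m ∸ d
        i≡ = ℕ.≤-antisym i≤m∸d m∸d≤i
      ... | no _ = trans (cong at (ℕ.m∸n+n≡m d≤m)) end
      step′ : ∀ {k} → k < m ∸ d → at′ k ~ at′ (suc k)
      step′ {k} k< with k ≤? i | suc k ≤? i
      ... | yes _   | yes _   = step (ℕ.<-≤-trans k< (ℕ.m∸n≤m m d))
      ... | no _    | no _    = step (shift k<)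
      ... | no k≰i  | yes k<i = contradiction (ℕ.<⇒≤ k<i) k≰i
      ... | yes k≤i | no k≮i with ℕ.≤-antisym k≤i (ℕ.≮⇒≥ k≮i)
      ...   | refl = jump (shift k<)
      inner′ : ∀ {k} → 0 < k → k < m ∸ d → R (at′ k)
      inner′ {k} 0<k k< with k ≤? i
      ... | yes _ = inner 0<k (ℕ.<-≤-trans k< (ℕ.m∸n≤m m d))
      ... | no _  = inner (ℕ.<-≤-trans 0<k (ℕ.m≤m+n k d)) (shift k<)

    -- For a repeated vertex the second copy goes too, so `j ∸ i` indices are cut; for a chord only
    -- those strictly between go, `j ∸ suc i` of them, and `suc i < j` makes this number positive.
    shorten : ∀ {a b m} (w : Walk R a b m) → let open Walk w in
              ∀ {i j} → i < j → j ≤ m → (at i ≡ at j) ⊎ (suc i < j × at i ~ at j) →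
              ∃[ k ] (k < m × Walk R a b k)
    shorten {m = m} w {i} {j} i<j j≤m (inj₁ eq) = m ∸ (j ∸ i) ,
      ℕ.∸-monoʳ-< (ℕ.m<n⇒0<n∸m i<j) (ℕ.≤-trans (ℕ.m∸n≤m j i) j≤m) ,
      skip w i (j ∸ i) (subst (_≤ m) (sym i+d≡j) j≤m)
        (λ lt → subst (λ k → at i ~ at (suc k)) (sym i+d≡j)
          (subst (_~ at (suc j)) (sym eq) (step (subst (_< m) i+d≡j lt))))
        (λ i+d≡m → trans eq (cong at (trans (sym i+d≡j) i+d≡m)))
      where
      open Walk w
      i+d≡j : i + (j ∸ i) ≡ j
      i+d≡j = ℕ.m+[n∸m]≡n (ℕ.<⇒≤ i<j)
    shorten {m = m} w {i} {j} i<j j≤m (inj₂ (1+i<j , adj)) = m ∸ (j ∸ suc i) ,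
      ℕ.∸-monoʳ-< (ℕ.m<n⇒0<n∸m 1+i<j) (ℕ.≤-trans (ℕ.m∸n≤m j (suc i)) j≤m) ,
      skip w i (j ∸ suc i) (ℕ.<⇒≤ i+d<m)
        (λ _ → subst (λ k → at i ~ at k) (sym 1+i+d≡j) adj)
        (λ i+d≡m → contradiction i+d≡m (ℕ.<⇒≢ i+d<m))
      where
      open Walk w
      1+i+d≡j : suc i + (j ∸ suc i) ≡ j
      1+i+d≡j = ℕ.m+[n∸m]≡n i<j
      i+d<m : i + (j ∸ suc i) < m
      i+d<m = subst (_≤ m) (sym 1+i+d≡j) j≤m

  -- Closing up a walk through x gives a cycle; as x has no chord to the inner
  -- vertices, every chord or repetition shortens the walk.
  ends-adjacent : Chordal G → ∀ {x a b} → a ~ x → b ~ x → a ≢ b → ∀ {m} →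
                  Walk (λ v → v ≢ x × ¬ v ~ x) a b m → a ~ b
  ends-adjacent chordal {x} {a} {b} a~x b~x a≢b w = go (<-wellFounded _) w
    where
    Far : Pred (Fin n) 0ℓ
    Far v = v ≢ x × ¬ v ~ x

    shorter : ∀ {m} → Walk Far a b (suc (suc m)) → ∃[ k ] (k < suc (suc m) × Walk Far a b k)
    shorter {m} w with any? {suc (suc (suc m))} (λ i → any? {suc (suc (suc m))} λ j →
                       (toℕ i ℕ.<? toℕ j) ×-dec (Walk.at w (toℕ i) ≟ Walk.at w (toℕ j)))
    ... | yes (i , j , i<j , eq) = shorten w i<j (toℕ≤pred[n] j) (inj₁ eq)
    -- Together with `x`, the `m + 3` distinct vertices of the walk form a cycle of length `m + 4`,
    -- long enough for chordality.
    ... | no none = from-chord (chordal (suc (suc k)) (s≤s (s≤s (s≤s (s≤s z≤n)))) cycle)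
      where
      open Walk w
      k : ℕ
      k = suc (suc m)
      at-injective : {i j : Fin (suc k)} → at (toℕ i) ≡ at (toℕ j) → i ≡ j
      at-injective {i} {j} eq with ℕ.<-cmp (toℕ i) (toℕ j)
      ... | tri< i<j _ _ = contradiction (i , j , i<j , eq) none
      ... | tri≈ _ i≡j _ = toℕ-injective i≡j
      ... | tri> _ _ j<i = contradiction (j , i , j<i , sym eq) none
      far : {i : Fin (suc k)} → toℕ i ≢ 0 → toℕ i ≢ k → Far (at (toℕ i))
      far {i} i≢0 i≢k = inner (ℕ.n≢0⇒n>0 i≢0) (ℕ.≤∧≢⇒< (toℕ≤pred[n] i) i≢k)
      at≢x : (i : Fin (suc k)) → at (toℕ i) ≢ x
      at≢x i eq with toℕ i ℕ.≟ 0 | toℕ i ℕ.≟ k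
      ... | yes i≡0 | _       = ~-irrefl (trans (sym start) (trans (cong at (sym i≡0)) eq)) a~x
      ... | no _    | yes i≡k = ~-irrefl (trans (sym end) (trans (cong at (sym i≡k)) eq)) b~x
      ... | no i≢0  | no i≢k  = proj₁ (far i≢0 i≢k) eq
      vertex : Fin (suc (suc k)) → Fin n
      vertex zero    = x
      vertex (suc i) = at (toℕ i)
      vertex-injective : ∀ {i j} → vertex i ≡ vertex j → i ≡ j
      vertex-injective {zero}  {zero}  _  = refl
      vertex-injective {zero}  {suc j} eq = contradiction (sym eq) (at≢x j)
      vertex-injective {suc i} {zero}  eq = contradiction eq (at≢x i)
      vertex-injective {suc i} {suc j} eq = cong suc (at-injective eq)
      edge : ∀ i j → Next i j → vertex i ~ vertex j
      edge zero    zero    (inj₂ ())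
      edge zero    (suc j) (inj₁ eq) =
        subst (x ~_) (trans (sym start) (cong at (sym (ℕ.suc-injective eq)))) (~-sym a~x)
      edge (suc i) zero    (inj₂ (eq , _)) =
        subst (_~ x) (trans (sym end) (cong at (sym (ℕ.suc-injective (ℕ.suc-injective eq))))) b~x
      edge (suc i) (suc j) (inj₁ eq) = subst (at (toℕ i) ~_) (cong at (sym j≡1+i))
        (step (subst (_≤ k) j≡1+i (toℕ≤pred[n] j)))
        where
        j≡1+i : toℕ j ≡ suc (toℕ i)
        j≡1+i = ℕ.suc-injective eq
      cycle : Cycle G (suc (suc k))
      cycle = record { vertex = vertex ; injective = vertex-injective ; edge = edge }
      -- The cyclic neighbours of `x` are the two ends of the walk; every other vertex of the walk
      -- is inner, hence far from `x`.
      x-chordless : (j : Fin (suc k)) → ¬ Consecutive zero (Fin.suc j) → ¬ at (toℕ j) ~ x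
      x-chordless j ¬cons = proj₂ (far
        (λ j≡0 → ¬cons (inj₁ (inj₁ (cong ℕ.suc j≡0))))
        (λ j≡k → ¬cons (inj₂ (inj₂ (cong (λ i → ℕ.suc (ℕ.suc i)) j≡k , refl)))))
      from-chord : HasChord G cycle → ∃[ l ] (l < k × Walk Far a b l)
      from-chord (zero  , zero  , i≢j , _) = contradiction refl i≢j
      from-chord (zero  , suc j , _ , ¬cons , x~) = contradiction (~-sym x~) (x-chordless j ¬cons)
      from-chord (suc i , zero  , _ , ¬cons , ~x) =
        contradiction ~x (x-chordless i (¬cons ∘ [ inj₂ , inj₁ ]′))
      from-chord (suc i , suc j , i≢j , ¬cons , adj) with ℕ.<-cmp (toℕ i) (toℕ j)
      ... | tri≈ _ i≡j _ = contradiction (cong suc (toℕ-injective i≡j)) i≢j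
      ... | tri< i<j _ _ = shorten w i<j (toℕ≤pred[n] j)
        (inj₂ (ℕ.≤∧≢⇒< i<j (λ eq → ¬cons (inj₁ (inj₁ (cong suc (sym eq))))) , adj))
      ... | tri> _ _ j<i = shorten w j<i (toℕ≤pred[n] i)
        (inj₂ (ℕ.≤∧≢⇒< j<i (λ eq → ¬cons (inj₂ (inj₁ (cong suc (sym eq))))) , ~-sym adj))

    go : ∀ {m} → Acc _<_ m → Walk Far a b m → a ~ b
    go {zero} _ w = contradiction (trans (sym start) end) a≢b
      where open Walk w
    go {suc zero} _ w = subst (_~ b) start (subst (at 0 ~_) end (step z<s))
      where open Walk w
    go {suc (suc m)} (acc rec) w with shorter w
    ... | _ , k<m , w′ = go (rec k<m) w′

  -- Simplicial vertices of chordal graphs.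

  Simplicial : Subset n → Pred (Fin n) 0ℓ
  Simplicial W z = ∀ {u v} → u ∈ W → v ∈ W → u ~ z → v ~ z → u ≢ v → u ~ v

  -- The component C of y in W minus the closed neighbourhood of x is attached
  -- to the rest of W by a clique.
  component : Chordal G → ∀ {W x y} → y ∈ W → y ≢ x → ¬ y ~ x →
              ∃[ C ] (y ∈ C × (∀ {c} → c ∈ C → c ∈ W × c ≢ x × ¬ c ~ x) ×
                      (∀ {s t c d} → s ∈ W → t ∈ W → s ∉ C → t ∉ C → c ∈ C → d ∈ C →
                       s ~ c → t ~ d → s ≢ t → s ~ t))
  component chordal {W} {x} {y} y∈W y≢x y≁x = C , y∈C , region , attached
    where
    Far : Pred (Fin n) 0ℓ
    Far v = v ≢ x × ¬ v ~ x
    -- Constraining both ends keeps `E` symmetric, so that paths from `y` can be reversed.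
    E : Rel (Fin n) 0ℓ
    E u v = u ~ v × (u ∈ W × Far u) × (v ∈ W × Far v)
    far? : Decidable (λ v → v ∈ W × Far v)
    far? v = (v ∈? W) ×-dec (¬? (v ≟ x) ×-dec ¬? (v ~? x))
    reach : ∃[ C ] (y ∈ C × (∀ {c} → c ∈ C → Star E y c) × (∀ {c w} → c ∈ C → E c w → w ∈ C))
    reach = reachable (λ u v → (u ~? v) ×-dec (far? u ×-dec far? v)) y
    C : Subset n
    C = proj₁ reach
    y∈C : y ∈ C
    y∈C = proj₁ (proj₂ reach)
    path : ∀ {c} → c ∈ C → Star E y c
    path = proj₁ (proj₂ (proj₂ reach))
    closed : ∀ {c w} → c ∈ C → E c w → w ∈ C
    closed = proj₂ (proj₂ (proj₂ reach))
    far-end : ∀ {u v} → u ∈ W × Far u → Star E u v → v ∈ W × Far v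
    far-end p ε = p
    far-end _ ((_ , _ , q) ◅ es) = far-end q es
    region : ∀ {c} → c ∈ C → c ∈ W × Far c
    region c∈C = far-end (y∈W , y≢x , y≁x) (path c∈C)
    E-sym : ∀ {u v} → E u v → E v u
    E-sym (u~v , p , q) = ~-sym u~v , q , p
    walk : ∀ {u v t} → Star E u v → v ~ t → ∃ (Walk Far u t)
    walk ε v~t = 1 , edge-walk v~t
    walk ((u~v , _ , q) ◅ es) v~t with walk es v~t
    ... | m , w = suc m , cons-walk u~v (proj₂ q) w
    -- Otherwise `s` would be far from `x` and `C` would have absorbed it.
    to-x : ∀ {s c} → s ∈ W → s ∉ C → c ∈ C → s ~ c → s ~ x
    to-x {s} {c} s∈W s∉C c∈C s~c = decidable-stable (s ~? x) λ s≁x →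
      s∉C (closed c∈C (~-sym s~c , region c∈C , s∈W , s≢x , s≁x))
      where
      s≢x : s ≢ x
      s≢x refl = proj₂ (proj₂ (region c∈C)) (~-sym s~c)
    attached : ∀ {s t c d} → s ∈ W → t ∈ W → s ∉ C → t ∉ C → c ∈ C → d ∈ C →
               s ~ c → t ~ d → s ≢ t → s ~ t
    -- A walk from `s` into `C`, via `y`, and out to `t` has all inner vertices far from `x`, while
    -- `s` and `t` are adjacent to `x`.
    attached s∈W t∈W s∉C t∉C c∈C d∈C s~c t~d s≢t
      with walk (reverse E-sym (path c∈C) ◅◅ path d∈C) (~-sym t~d)
    ... | _ , w = ends-adjacent chordal (to-x s∈W s∉C c∈C s~c) (to-x t∈W t∉C d∈C t~d) s≢t
      (cons-walk s~c (proj₂ (region c∈C)) w)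

  -- A strengthening of the existence of a simplicial vertex that suits induction: avoiding a
  -- prescribed clique keeps the vertex found in a smaller set off the separator. Existence itself
  -- is the case `K = ⊥`.
  SimplicialOutside : Subset n → Set
  SimplicialOutside W = ∀ {K} → K ⊆ W → IsClique G K → ∀ {y} → y ∈ W → y ∉ K →
                        ∃[ z ] (z ∈ W × z ∉ K × Simplicial W z)

  -- The induction hypothesis is applied to the component `C` enlarged by its attachment `K′`, which
  -- is a clique; this set omits `x`. The vertex found lies in `C`, and all its neighbours in `W`
  -- belong to the smaller set, so it is simplicial in `W` as well.
  far-simplicial : Chordal G → ∀ {W} → (∀ {W′} → W′ ⊂ W → SimplicialOutside W′) →
                   ∀ {x y} → x ∈ W → y ∈ W → y ≢ x → ¬ y ~ x →
                   ∃[ z ] (z ∈ W × z ≢ x × ¬ z ~ x × Simplicial W z)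
  far-simplicial chordal {W} smaller {x} {y} x∈W y∈W y≢x y≁x
    with component chordal y∈W y≢x y≁x
  ... | C , y∈C , region , attached = conclude
      (smaller W′⊂W K′⊆W′ K′-clique
        (∈-comprehension⁺ W′? (y∈W , inj₁ y∈C)) λ y∈K′ → proj₁ (proj₂ (∈-comprehension⁻ K′? y∈K′)) y∈C)
    where
    touches? : Decidable (λ v → ∃[ c ] (c ∈ C × v ~ c))
    touches? v = any? λ c → (c ∈? C) ×-dec (v ~? c)
    W′? : Decidable (λ v → v ∈ W × (v ∈ C ⊎ ∃[ c ] (c ∈ C × v ~ c)))
    W′? v = (v ∈? W) ×-dec ((v ∈? C) ⊎-dec touches? v)
    K′? : Decidable (λ v → v ∈ W × v ∉ C × ∃[ c ] (c ∈ C × v ~ c))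
    K′? v = (v ∈? W) ×-dec (¬? (v ∈? C) ×-dec touches? v)
    W′ K′ : Subset n
    W′ = comprehension W′?
    K′ = comprehension K′?
    x∉W′ : x ∉ W′
    x∉W′ x∈W′ with ∈-comprehension⁻ W′? x∈W′
    ... | _ , inj₁ x∈C = proj₁ (proj₂ (region x∈C)) refl
    ... | _ , inj₂ (c , c∈C , x~c) = proj₂ (proj₂ (region c∈C)) (~-sym x~c)
    W′⊂W : W′ ⊂ W
    W′⊂W = (λ v∈ → proj₁ (∈-comprehension⁻ W′? v∈)) , x , x∈W , x∉W′
    K′⊆W′ : K′ ⊆ W′
    K′⊆W′ v∈ with ∈-comprehension⁻ K′? v∈
    ... | v∈W , _ , t = ∈-comprehension⁺ W′? (v∈W , inj₂ t)
    K′-clique : IsClique G K′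
    K′-clique u v u∈ v∈ u≢v with ∈-comprehension⁻ K′? u∈ | ∈-comprehension⁻ K′? v∈
    ... | u∈W , u∉C , c , c∈C , u~c | v∈W , v∉C , d , d∈C , v~d =
      attached u∈W v∈W u∉C v∉C c∈C d∈C u~c v~d u≢v
    conclude : ∃[ z ] (z ∈ W′ × z ∉ K′ × Simplicial W′ z) →
               ∃[ z ] (z ∈ W × z ≢ x × ¬ z ~ x × Simplicial W z)
    conclude (z , z∈W′ , z∉K′ , simplicial) =
      z , proj₁ (region z∈C) , proj₁ (proj₂ (region z∈C)) , proj₂ (proj₂ (region z∈C)) ,
      λ u∈W v∈W u~z v~z → simplicial (near u∈W u~z) (near v∈W v~z) u~z v~z
      where
      z∈C : z ∈ C
      z∈C with ∈-comprehension⁻ W′? z∈W′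
      ... | _ , inj₁ z∈C = z∈C
      ... | z∈W , inj₂ t = decidable-stable (z ∈? C) λ z∉C → z∉K′ (∈-comprehension⁺ K′? (z∈W , z∉C , t))
      near : ∀ {u} → u ∈ W → u ~ z → u ∈ W′
      near u∈W u~z = ∈-comprehension⁺ W′? (u∈W , inj₂ (z , z∈C , u~z))

  -- If some vertex other than `y` lies outside `K`, induction applies to `W - y`, and putting back
  -- the universal `y` preserves simpliciality. Otherwise the neighbours of `y` in `W` all lie in
  -- the clique `K`, and `y` itself is simplicial.
  universal-step : ∀ {W} → (∀ {W′} → W′ ⊂ W → SimplicialOutside W′) →
                   ∀ {K} → K ⊆ W → IsClique G K → ∀ {y} → y ∈ W → y ∉ K →
                   (∀ {v} → v ∈ W → v ≢ y → v ~ y) → ∃[ z ] (z ∈ W × z ∉ K × Simplicial W z)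
  universal-step {W} smaller {K} K⊆W clique {y} y∈W y∉K universal
    with any? (λ v → (v ∈? W) ×-dec (¬? (v ≟ y) ×-dec ¬? (v ∈? K)))
  ... | yes (v , v∈W , v≢y , v∉K) =
    let z , z∈ , z∉K , simplicial = smaller (x∈p⇒p-x⊂p y∈W) K⊆W-y clique (x∈p∧x≢y⇒x∈p-y v∈W v≢y) v∉K
    in z , p─q⊆p W ⁅ y ⁆ z∈ , z∉K , extended simplicial
    where
    K⊆W-y : K ⊆ W - y
    K⊆W-y {k} k∈K = x∈p∧x≢y⇒x∈p-y (K⊆W k∈K) λ k≡y → y∉K (subst (_∈ K) k≡y k∈K)
    extended : ∀ {z} → Simplicial (W - y) z → Simplicial W z
    extended simplicial {u} {v} u∈W v∈W u~z v~z u≢v with u ≟ y | v ≟ y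
    ... | yes refl | _        = ~-sym (universal v∈W (≢-sym u≢v))
    ... | no u≢y   | yes refl = universal u∈W u≢y
    ... | no u≢y   | no v≢y   =
      simplicial (x∈p∧x≢y⇒x∈p-y u∈W u≢y) (x∈p∧x≢y⇒x∈p-y v∈W v≢y) u~z v~z u≢v
  ... | no rest = y , y∈W , y∉K , λ u∈W v∈W u~y v~y → clique _ _ (inK u∈W u~y) (inK v∈W v~y)
    where
    inK : ∀ {u} → u ∈ W → u ~ y → u ∈ K
    inK {u} u∈W u~y = decidable-stable (u ∈? K) λ u∉K →
      rest (u , u∈W , (λ u≡y → ~-irrefl u≡y u~y) , u∉K)

  -- A simplicial vertex far from a member of `K` is outside `K`. If `y` is adjacent to all of `K`,
  -- one far from `y` is outside `K` too. The remaining case is that `y` is universal in `W`.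
  outside-step : Chordal G → ∀ {W} → (∀ {W′} → W′ ⊂ W → SimplicialOutside W′) → SimplicialOutside W
  outside-step chordal {W} smaller {K} K⊆W clique {y} y∈W y∉K
    with any? (λ k → (k ∈? K) ×-dec ¬? (y ~? k)) | any? (λ v → (v ∈? W) ×-dec (¬? (v ≟ y) ×-dec ¬? (v ~? y)))
  ... | yes (k , k∈K , y≁k) | _ =
    let z , z∈W , z≢k , z≁k , simplicial =
          far-simplicial chordal smaller (K⊆W k∈K) y∈W (λ y≡k → y∉K (subst (_∈ K) (sym y≡k) k∈K)) y≁k
    in z , z∈W , (λ z∈K → z≁k (clique z k z∈K k∈K z≢k)) , simplicial
  ... | no none | yes (v , v∈W , v≢y , v≁y) =
    let z , z∈W , z≢y , z≁y , simplicial = far-simplicial chordal smaller y∈W v∈W v≢y v≁y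
    in z , z∈W , (λ z∈K → none (z , z∈K , z≁y ∘ ~-sym)) , simplicial
  ... | no _ | no none = universal-step smaller K⊆W clique y∈W y∉K λ {v} v∈W v≢y →
    decidable-stable (v ~? y) λ v≁y → none (v , v∈W , v≢y , v≁y)

  simplicial-outside : Chordal G → ∀ {W} → Acc _⊂_ W → SimplicialOutside W
  simplicial-outside chordal (acc rec) = outside-step chordal λ W′⊂W → simplicial-outside chordal (rec W′⊂W)

  -- Perfect elimination.

  data Elimination (W : Subset n) : Set where
    done      : (∀ {v} → v ∉ W) → Elimination W
    eliminate : ∀ z → z ∈ W → Simplicial W z → Elimination (W - z) → Elimination W

  elimination : Chordal G → ∀ {W} → Acc _⊂_ W → Elimination W
  elimination chordal {W} (acc rec) with nonempty? W
  ... | no empty = done λ v∈W → empty (_ , v∈W)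
  ... | yes (y , y∈W) with simplicial-outside chordal (⊂-wellFounded W)
                             (λ v∈⊥ → contradiction v∈⊥ ∉⊥) (λ _ _ u∈⊥ → contradiction u∈⊥ ∉⊥) y∈W ∉⊥
  ...   | z , z∈W , _ , simplicial =
    eliminate z z∈W simplicial (elimination chordal (rec (x∈p⇒p-x⊂p z∈W)))

  -- Greedy colouring with ω colours.

  clique-≤-ω : (f : Fin m → Fin n) → (∀ {i j} → i ≢ j → f i ~ f j) → m ≤ ω G
  clique-≤-ω f adjacent =
    let p , m≤∣p∣ , inv = image f injective
    in ℕ.≤-trans m≤∣p∣ (proj₂ (proj₂ (cliqueNumber G)) ∣ p ∣ (p , clique inv , refl))
    where
    injective : ∀ {i j} → f i ≡ f j → i ≡ j
    injective {i} {j} eq = decidable-stable (i ≟ j) λ i≢j → ~-irrefl eq (adjacent i≢j)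
    clique : ∀ {p} → (∀ {v} → v ∈ p → ∃[ i ] f i ≡ v) → IsClique G p
    clique inv u v u∈p v∈p u≢v with inv u∈p | inv v∈p
    ... | i , refl | j , refl = adjacent λ { refl → u≢v refl }

  record Colouring (W : Subset n) : Set where
    field
      colour : Fin n → ℕ
      bound  : ∀ {v} → v ∈ W → colour v < ω G
      proper : ∀ {u v} → u ∈ W → v ∈ W → u ~ v → colour u ≢ colour v

  -- If all ω colours occurred among the neighbours of `z`, one representative of each colour
  -- together with `z` would form a clique of size ω + 1.
  free-colour : ∀ {W z} (c : Fin n → ℕ) → Simplicial W z →
                ∃[ i ] (i < ω G × ∀ {w} → w ∈ W → w ~ z → c w ≢ i)
  free-colour {W} {z} c simplicial
    with any? {ω G} (λ i → ¬? (any? λ w → (w ∈? W) ×-dec ((w ~? z) ×-dec (c w ℕ.≟ toℕ i))))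
  ... | yes (i , free) = toℕ i , toℕ<n i , λ {w} w∈W w~z eq → free (w , w∈W , w~z , eq)
  ... | no used = contradiction (clique-≤-ω with-z adjacent) (ℕ.<-irrefl refl)
    where
    representative : (i : Fin (ω G)) → ∃[ w ] (w ∈ W × w ~ z × c w ≡ toℕ i)
    representative i =
      decidable-stable (any? λ w → (w ∈? W) ×-dec ((w ~? z) ×-dec (c w ℕ.≟ toℕ i))) λ free → used (i , free)
    with-z : Fin (suc (ω G)) → Fin n
    with-z zero    = z
    with-z (suc i) = proj₁ (representative i)
    adjacent : ∀ {i j} → i ≢ j → with-z i ~ with-z j
    adjacent {zero}  {zero}  i≢j = contradiction refl i≢j
    adjacent {zero}  {suc j} _   = let _ , _ , w~z , _ = representative j in ~-sym w~z
    adjacent {suc i} {zero}  _   = let _ , _ , w~z , _ = representative i in w~z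
    adjacent {suc i} {suc j} i≢j =
      let u , u∈W , u~z , cu≡i = representative i
          v , v∈W , v~z , cv≡j = representative j
      in simplicial u∈W v∈W u~z v~z λ u≡v →
           i≢j (cong suc (toℕ-injective (trans (sym cu≡i) (trans (cong c u≡v) cv≡j))))

  colouring : ∀ {W} → Elimination W → Colouring W
  colouring (done empty) = record
    { colour = const 0
    ; bound  = λ v∈W → contradiction v∈W empty
    ; proper = λ u∈W → contradiction u∈W empty
    }
  colouring {W} (eliminate z _ simplicial e) = record { colour = colour′ ; bound = bound′ ; proper = proper′ }
    where
    open Colouring (colouring e)
    free : ∃[ i ] (i < ω G × ∀ {w} → w ∈ W → w ~ z → colour w ≢ i)
    free = free-colour colour simplicial
    colour′ : Fin n → ℕ
    colour′ = updateAt colour z (const (proj₁ free))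
    old : ∀ {v} → v ≢ z → colour′ v ≡ colour v
    old {v} v≢z = updateAt-minimal v z colour v≢z
    new : colour′ z ≡ proj₁ free
    new = updateAt-updates z colour
    bound′ : ∀ {v} → v ∈ W → colour′ v < ω G
    bound′ {v} v∈W with v ≟ z
    ... | yes refl = subst (_< ω G) (sym new) (proj₁ (proj₂ free))
    ... | no v≢z   = subst (_< ω G) (sym (old v≢z)) (bound (x∈p∧x≢y⇒x∈p-y v∈W v≢z))
    distinct : ∀ {u} → u ∈ W → u ~ z → colour′ u ≢ colour′ z
    distinct {u} u∈W u~z eq = proj₂ (proj₂ free) u∈W u~z
      (trans (sym (old λ u≡z → ~-irrefl u≡z u~z)) (trans eq new))
    proper′ : ∀ {u v} → u ∈ W → v ∈ W → u ~ v → colour′ u ≢ colour′ v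
    proper′ {u} {v} u∈W v∈W u~v eq with u ≟ z | v ≟ z
    ... | yes refl | _        = distinct v∈W (~-sym u~v) (sym eq)
    ... | no _     | yes refl = distinct u∈W u~v eq
    ... | no u≢z   | no v≢z   = proper (x∈p∧x≢y⇒x∈p-y u∈W u≢z) (x∈p∧x≢y⇒x∈p-y v∈W v≢z) u~v
      (trans (sym (old u≢z)) (trans eq (old v≢z)))

  -- The forest and its nested intervals.

  -- The intervals [lo , hi] represent the forest: u is an ancestor of v when
  -- lo u ≤ lo v ≤ hi u.
  record Layout (W : Subset n) : Set where
    field
      rank lo hi : Fin n → ℕ
      lo≤hi      : ∀ {v} → v ∈ W → lo v ≤ hi v
      meet       : ∀ {u v} → u ∈ W → v ∈ W → u ~ v → lo u ≤ hi v
      nest       : ∀ {u v} → u ∈ W → v ∈ W → u ≢ v → lo u ≤ lo v → lo v ≤ hi u →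
                   rank u < rank v × (∀ {w} → w ∈ W → w ~ v → rank w ≤ rank u → w ≡ u ⊎ w ~ u)

  -- The intervals containing `t` become those of the ancestors of `z`. The first condition puts the
  -- neighbours of `z` among them, the second is the path property for `z`.
  Insertable : ∀ {W z} → Layout (W - z) → ℕ → Set
  Insertable {W} {z} L t =
    (∀ {x} → x ∈ W - z → x ~ z → lo x ≤ t × t ≤ hi x) ×
    (∀ {x w} → x ∈ W - z → lo x ≤ t → t ≤ hi x → w ∈ W - z → w ~ z → rank w ≤ rank x → w ≡ x ⊎ w ~ x)
    where open Layout L

  insert : ∀ {W z} (L : Layout (W - z)) → ∃ (Insertable {W} {z} L) → Layout W
  insert {W} {z} L (t , stab , ancestors) = record
    { rank = rank′ ; lo = lo′ ; hi = hi′ ; lo≤hi = lo≤hi′ ; meet = meet′ ; nest = nest′ }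
    where
    open Layout L
    -- Above every rank in use, so ranks record the order of insertion.
    top : ℕ
    top = suc (max 0 (map rank (allFin n)))
    rank′ lo′ hi′ : Fin n → ℕ
    rank′ = updateAt rank z (const top)
    lo′ = updateAt (raise-lo t ∘ lo) z (const (suc t))
    hi′ = updateAt (raise-hi t ∘ hi) z (const (suc t))
    rank-z : rank′ z ≡ top
    rank-z = updateAt-updates z rank
    lo-z : lo′ z ≡ suc t
    lo-z = updateAt-updates z (raise-lo t ∘ lo)
    hi-z : hi′ z ≡ suc t
    hi-z = updateAt-updates z (raise-hi t ∘ hi)
    rank-old : ∀ {v} → v ≢ z → rank′ v ≡ rank v
    rank-old {v} = updateAt-minimal v z rank
    lo-old : ∀ {v} → v ≢ z → lo′ v ≡ raise-lo t (lo v)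
    lo-old {v} = updateAt-minimal v z (raise-lo t ∘ lo)
    hi-old : ∀ {v} → v ≢ z → hi′ v ≡ raise-hi t (hi v)
    hi-old {v} = updateAt-minimal v z (raise-hi t ∘ hi)
    rank<top : ∀ v → rank v < top
    rank<top v = s≤s (≤-max rank v)
    in-rest : ∀ {v} → v ∈ W → v ≢ z → v ∈ W - z
    in-rest = x∈p∧x≢y⇒x∈p-y
    lo≤hi′ : ∀ {v} → v ∈ W → lo′ v ≤ hi′ v
    lo≤hi′ {v} v∈W with v ≟ z
    ... | yes refl = ℕ.≤-reflexive (trans lo-z (sym hi-z))
    ... | no v≢z   = subst₂ _≤_ (sym (lo-old v≢z)) (sym (hi-old v≢z)) (raise-mono t (lo≤hi (in-rest v∈W v≢z)))
    meet′ : ∀ {u v} → u ∈ W → v ∈ W → u ~ v → lo′ u ≤ hi′ v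
    meet′ {u} {v} u∈W v∈W u~v with u ≟ z | v ≟ z
    ... | yes refl | yes refl = contradiction u~v (~-irrefl refl)
    ... | yes refl | no v≢z   = subst₂ _≤_ (sym lo-z) (sym (hi-old v≢z))
      (≤-raise-hi t (proj₂ (stab (in-rest v∈W v≢z) (~-sym u~v))))
    ... | no u≢z   | yes refl = subst₂ _≤_ (sym (lo-old u≢z)) (sym hi-z)
      (raise-lo-≤ t (proj₁ (stab (in-rest u∈W u≢z) u~v)))
    ... | no u≢z   | no v≢z   = subst₂ _≤_ (sym (lo-old u≢z)) (sym (hi-old v≢z))
      (raise-mono t (meet (in-rest u∈W u≢z) (in-rest v∈W v≢z) u~v))
    nest′ : ∀ {u v} → u ∈ W → v ∈ W → u ≢ v → lo′ u ≤ lo′ v → lo′ v ≤ hi′ u →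
            rank′ u < rank′ v × (∀ {w} → w ∈ W → w ~ v → rank′ w ≤ rank′ u → w ≡ u ⊎ w ~ u)
    nest′ {u} {v} u∈W v∈W u≢v p q with u ≟ z | v ≟ z
    ... | yes refl | yes refl = contradiction refl u≢v
    ... | yes refl | no v≢z   = contradiction
      (ℕ.≤-antisym (subst₂ _≤_ (lo-old v≢z) hi-z q) (subst₂ _≤_ lo-z (lo-old v≢z) p)) (raise-lo≢ t (lo v))
    ... | no u≢z   | yes refl =
      subst₂ _<_ (sym (rank-old u≢z)) (sym rank-z) (rank<top u) ,
      λ {w} w∈W w~z rw≤ru → let w≢z = λ w≡z → ~-irrefl w≡z w~z in
        ancestors (in-rest u∈W u≢z) (raise-lo-≤⁻ t (subst₂ _≤_ (lo-old u≢z) lo-z p))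
          (≤-raise-hi⁻ t (subst₂ _≤_ lo-z (hi-old u≢z) q)) (in-rest w∈W w≢z) w~z
          (subst₂ _≤_ (rank-old w≢z) (rank-old u≢z) rw≤ru)
    ... | no u≢z   | no v≢z   =
      subst₂ _<_ (sym (rank-old u≢z)) (sym (rank-old v≢z)) (proj₁ old-nest) , earlier
      where
      old-nest = nest (in-rest u∈W u≢z) (in-rest v∈W v≢z) u≢v
        (raise-lo-cancel t (subst₂ _≤_ (lo-old u≢z) (lo-old v≢z) p))
        (raise-cancel t (subst₂ _≤_ (lo-old v≢z) (hi-old u≢z) q))
      earlier : ∀ {w} → w ∈ W → w ~ v → rank′ w ≤ rank′ u → w ≡ u ⊎ w ~ u
      earlier {w} w∈W w~v rw≤ru with w ≟ z
      -- The new vertex outranks `u`, so the path property for old vertices gains no new instance.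
      ... | yes refl = contradiction (subst₂ _≤_ rank-z (rank-old u≢z) rw≤ru) (ℕ.<⇒≱ (rank<top u))
      ... | no w≢z   = proj₂ old-nest (in-rest w∈W w≢z) w~v (subst₂ _≤_ (rank-old w≢z) (rank-old u≢z) rw≤ru)

  -- Ranks are shifted by one so that the value 0 can stand for the absence of neighbours and serve
  -- as the base case of `maximum`.
  last-neighbour : ∀ (W : Subset n) z (rank : Fin n → ℕ) → (∀ {w} → w ∈ W → ¬ w ~ z) ⊎
                   ∃[ p ] (p ∈ W × p ~ z × ∀ {w} → w ∈ W → w ~ z → rank w ≤ rank p)
  last-neighbour W z rank with maximum
    {P = λ k → k ≡ 0 ⊎ ∃[ w ] (w ∈ W × w ~ z × suc (rank w) ≡ k)}
    (λ k → (k ℕ.≟ 0) ⊎-dec any? λ w → (w ∈? W) ×-dec ((w ~? z) ×-dec (suc (rank w) ℕ.≟ k)))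
    (inj₁ refl) (suc (max 0 (map rank (allFin n))))
    (λ { _ (inj₁ refl) → z≤n ; _ (inj₂ (w , _ , _ , refl)) → s≤s (≤-max rank w) })
  ... | _ , inj₁ refl , greatest = inj₁ λ {w} w∈W w~z →
    contradiction (greatest (suc (rank w)) (inj₂ (w , w∈W , w~z , refl))) λ ()
  ... | _ , inj₂ (p , p∈W , p~z , refl) , greatest = inj₂ (p , p∈W , p~z , λ {w} w∈W w~z →
    ℕ.≤-pred (greatest (suc (rank w)) (inj₂ (w , w∈W , w~z , refl))))

  -- The parent of `z` is its last earlier neighbour `p`: the point `lo p` lies in the intervals of
  -- `p` and its ancestors only. Without neighbours, a point to the right of all intervals makes `z`
  -- a root.
  insertion-point : ∀ {W z} → Simplicial W z → (L : Layout (W - z)) → ∃ (Insertable {W} {z} L)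
  insertion-point {W} {z} simplicial L with last-neighbour (W - z) z (Layout.rank L)
  ... | inj₁ isolated = suc (max 0 (map hi (allFin n))) ,
    (λ x∈ x~z → contradiction x~z (isolated x∈)) ,
    (λ {x} _ _ t≤hi → contradiction (≤-max hi x) (ℕ.<⇒≱ t≤hi))
    where open Layout L
  ... | inj₂ (p , p∈ , p~z , last) = lo p , stab , ancestors
    where
    open Layout L
    adjacent : ∀ {w} → w ∈ W - z → w ~ z → w ≢ p → w ~ p
    adjacent w∈ w~z w≢p = simplicial (p─q⊆p W ⁅ z ⁆ w∈) (p─q⊆p W ⁅ z ⁆ p∈) w~z p~z w≢p
    stab : ∀ {x} → x ∈ W - z → x ~ z → lo x ≤ lo p × lo p ≤ hi x
    stab {x} x∈ x~z with x ≟ p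
    ... | yes refl = ℕ.≤-refl , lo≤hi x∈
    ... | no x≢p with lo x ≤? lo p | adjacent x∈ x~z x≢p
    ...   | yes lx≤lp | x~p = lx≤lp , meet p∈ x∈ (~-sym x~p)
    -- Here `p` would be an ancestor of `x` and so of smaller rank, against its choice as last
    -- neighbour.
    ...   | no lx≰lp  | x~p = contradiction (last x∈ x~z)
      (ℕ.<⇒≱ (proj₁ (nest p∈ x∈ (≢-sym x≢p) (ℕ.<⇒≤ (ℕ.≰⇒> lx≰lp)) (meet x∈ p∈ x~p))))
    ancestors : ∀ {x w} → x ∈ W - z → lo x ≤ lo p → lo p ≤ hi x →
                w ∈ W - z → w ~ z → rank w ≤ rank x → w ≡ x ⊎ w ~ x
    ancestors {x} {w} x∈ lx≤lp lp≤hx w∈ w~z rw≤rx with x ≟ p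
    ancestors {x} {w} x∈ lx≤lp lp≤hx w∈ w~z rw≤rx | yes refl with w ≟ x
    ... | yes w≡x = inj₁ w≡x
    ... | no w≢x  = inj₂ (adjacent w∈ w~z w≢x)
    -- For a proper ancestor `x` of `p`, the path property of `p` applies: `w` ranks below `p`,
    -- hence differs from it and is adjacent to it by simpliciality.
    ancestors {x} {w} x∈ lx≤lp lp≤hx w∈ w~z rw≤rx | no x≢p =
      let rx<rp , earlier = nest x∈ p∈ x≢p lx≤lp lp≤hx
      in earlier w∈ (adjacent w∈ w~z λ w≡p → ℕ.<⇒≢ (ℕ.≤-<-trans rw≤rx rx<rp) (cong rank w≡p)) rw≤rx

  layout : ∀ {W} → Elimination W → Layout W
  layout (done empty) = record
    { rank = const 0 ; lo = const 0 ; hi = const 0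
    ; lo≤hi   = λ _ → z≤n
    ; meet = λ _ _ _ → z≤n
    ; nest    = λ u∈W → contradiction u∈W empty
    }
  layout (eliminate z _ simplicial e) = insert (layout e) (insertion-point simplicial (layout e))

  -- The boxes.

  -- The i-th colour class is laid out as distinct points, ordered by rank; every
  -- other vertex v gets an interval that reaches from its first point up to a
  -- common right end, so it misses the ancestors of v of colour i that are not
  -- adjacent to v.
  module ColourGrid (c : Colouring ⊤) (L : Layout ⊤) where
    open Colouring c
    open Layout L

    -- With `rank v` as a candidate the minimum exists, and it falls below `rank v` only through an
    -- earlier neighbour of colour `i`.
    Anchor : ℕ → Fin n → Pred ℕ 0ℓ
    Anchor i v k = k ≡ rank v ⊎ ∃[ w ] (w ~ v × colour w ≡ i × rank w ≡ k)

    anchor : ∀ i v → ∃ (IsMinimum (Anchor i v))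
    anchor i v = minimum
      (λ k → (k ℕ.≟ rank v) ⊎-dec any? λ w → (w ~? v) ×-dec ((colour w ℕ.≟ i) ×-dec (rank w ℕ.≟ k)))
      (rank v) (inj₁ refl)

    left : ℕ → Fin n → ℕ
    left i v = proj₁ (anchor i v)

    left-≤-rank : ∀ i v → left i v ≤ rank v
    left-≤-rank i v = proj₂ (proj₂ (anchor i v)) (rank v) (inj₁ refl)

    left-≤-neighbour : ∀ {u v} → u ~ v → left (colour v) u ≤ rank v
    left-≤-neighbour {u} {v} u~v =
      proj₂ (proj₂ (anchor (colour v) u)) (rank v) (inj₂ (v , ~-sym u~v , refl , refl))

    end : ℕ
    end = max 0 (map rank (allFin n))

    l h : Fin (suc (ω G)) → Fin n → ℕ
    l zero    v = lo v
    l (suc i) v with colour v ℕ.≟ toℕ i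
    ... | yes _ = rank v
    ... | no _  = left (toℕ i) v
    h zero    v = hi v
    h (suc i) v with colour v ℕ.≟ toℕ i
    ... | yes _ = rank v
    ... | no _  = end

    l≤h : ∀ i v → l i v ≤ h i v
    l≤h zero    v = lo≤hi ∈⊤
    l≤h (suc i) v with colour v ℕ.≟ toℕ i
    ... | yes _ = ℕ.≤-refl
    ... | no _  = ℕ.≤-trans (left-≤-rank (toℕ i) v) (≤-max rank v)

    edge⇒meet : ∀ {u v} → u ~ v → ∀ i → l i u ≤ h i v
    edge⇒meet u~v zero = meet ∈⊤ ∈⊤ u~v
    edge⇒meet {u} {v} u~v (suc i) with colour u ℕ.≟ toℕ i | colour v ℕ.≟ toℕ i
    ... | yes cu≡i | yes cv≡i = contradiction (trans cu≡i (sym cv≡i)) (proper ∈⊤ ∈⊤ u~v)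
    ... | yes _    | no _     = ≤-max rank u
    ... | no _     | yes cv≡i = subst (λ i → left i u ≤ rank v) cv≡i (left-≤-neighbour u~v)
    ... | no _     | no _     = ℕ.≤-trans (left-≤-rank (toℕ i) u) (≤-max rank u)

    -- The coordinate of the colour of the ancestor `u` decides. There `u` is the point `rank u`,
    -- below `rank v`, so `v` reaches it only through a neighbour `w` of that colour with rank at
    -- most `rank u`. By the path property `w` is `u` or adjacent to `u`, and equal colours exclude
    -- the latter.
    nested-meet⇒edge : ∀ {u v} → u ≢ v → lo u ≤ lo v → lo v ≤ hi u → (∀ i → l i v ≤ h i u) → u ~ v
    nested-meet⇒edge {u} {v} u≢v lu≤lv lv≤hu meets = decide (meets (suc i))
      where
      i : Fin (ω G)
      i = fromℕ< (bound {u} ∈⊤)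
      cu≡i : colour u ≡ toℕ i
      cu≡i = sym (toℕ-fromℕ< (bound {u} ∈⊤))
      ru<rv : rank u < rank v
      ru<rv = proj₁ (nest ∈⊤ ∈⊤ u≢v lu≤lv lv≤hu)
      anchored : ∀ {k} → Anchor (toℕ i) v k → k ≤ rank u → u ~ v
      anchored (inj₁ refl) rv≤ru = contradiction rv≤ru (ℕ.<⇒≱ ru<rv)
      anchored (inj₂ (w , w~v , cw≡i , refl)) rw≤ru
        with proj₂ (nest ∈⊤ ∈⊤ u≢v lu≤lv lv≤hu) ∈⊤ w~v rw≤ru
      ... | inj₁ refl = w~v
      ... | inj₂ w~u  = contradiction (trans cw≡i (sym cu≡i)) (proper ∈⊤ ∈⊤ w~u)
      decide : l (suc i) v ≤ h (suc i) u → u ~ v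
      decide p with colour v ℕ.≟ toℕ i | colour u ℕ.≟ toℕ i
      ... | _     | no cu≢i = contradiction cu≡i cu≢i
      ... | yes _ | yes _   = contradiction p (ℕ.<⇒≱ ru<rv)
      ... | no _  | yes _   = anchored (proj₁ (proj₂ (anchor (toℕ i) v))) p

    isGrid : IsGrid G l h
    isGrid = l≤h , λ u v u≢v →
      (λ u~v i → edge⇒meet u~v i , edge⇒meet (~-sym u~v) i) ,
      -- Meeting in coordinate `zero` makes the vertices comparable; the smaller left end belongs to
      -- the ancestor.
      λ meets → [ (λ lu≤lv → nested-meet⇒edge u≢v lu≤lv (proj₂ (meets zero)) (proj₂ ∘ meets))
                , (λ lv≤lu → ~-sym (nested-meet⇒edge (≢-sym u≢v) lv≤lu (proj₁ (meets zero)) (proj₁ ∘ meets)))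
                ]′ (ℕ.≤-total (lo u) (lo v))

  box-≤-1+ω : Chordal G → box G ≤ suc (ω G)
  box-≤-1+ω chordal = proj₂ (proj₂ (boxicity G)) (suc (ω G)) (grid⇒representable G isGrid)
    where
    order : Elimination ⊤
    order = elimination chordal (⊂-wellFounded ⊤)
    open ColourGrid (colouring order) (layout order)

  -- Clique number and maximum degree.

  -- A nonempty clique lies in the closed neighbourhood of any of its vertices.
  clique-≤-1+Δ : ∀ p → IsClique G p → ∣ p ∣ ≤ suc (Δ G)
  clique-≤-1+Δ p clique with nonempty? p
  ... | no empty = ℕ.≤-trans (p⊆q⇒∣p∣≤∣q∣ {q = ⊥} λ v∈p → contradiction (_ , v∈p) empty)
    (subst (_≤ suc (Δ G)) (sym (∣⊥∣≡0 n)) z≤n)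
  ... | yes (v , v∈p) = begin
    ∣ p ∣                          ≤⟨ p⊆q⇒∣p∣≤∣q∣ p⊆ ⟩
    ∣ ⁅ v ⁆ ∪ neighbours G v ∣     ≤⟨ ∣p∪q∣≤∣p∣+∣q∣ ⁅ v ⁆ (neighbours G v) ⟩
    ∣ ⁅ v ⁆ ∣ + degree G v         ≡⟨ cong (_+ degree G v) (∣⁅x⁆∣≡1 v) ⟩
    suc (degree G v)               ≤⟨ s≤s (≤-max (degree G) v) ⟩
    suc (Δ G)                      ∎
    where
    open ℕ.≤-Reasoning
    p⊆ : p ⊆ ⁅ v ⁆ ∪ neighbours G v
    p⊆ {u} u∈p with u ≟ v
    ... | yes refl = p⊆p∪q (neighbours G v) (x∈⁅x⁆ u)
    ... | no u≢v   = q⊆p∪q ⁅ v ⁆ (neighbours G v)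
      (∈-comprehension⁺ (v ~?_) (clique v u v∈p u∈p (≢-sym u≢v)))

  ω-≤-1+Δ : ω G ≤ suc (Δ G)
  ω-≤-1+Δ = let p , clique , ∣p∣≡ω = proj₁ (proj₂ (cliqueNumber G))
            in subst (_≤ suc (Δ G)) ∣p∣≡ω (clique-≤-1+Δ p clique)

theorem5 : ∀ {n : ℕ} (G : Graph n) → Chordal G → box G ≤ ω G + 1 × ω G + 1 ≤ Δ G + 2
theorem5 G chordal =
  subst (box G ≤_) (ℕ.+-comm 1 (ω G)) (box-≤-1+ω G chordal) ,
  subst (ω G + 1 ≤_) (sym (ℕ.+-suc (Δ G) 1)) (ℕ.+-monoˡ-≤ 1 (ω-≤-1+Δ G))
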